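{- Let $\Psi$ be a set of atomic propositions. The logic $\mathrm{RSOL}$ is sound with respect to $\mathrm{SOL}$: for all terms $a,b\in\mathcal L_\Psi$, $$ \vdash_{\mathrm{RSOL}} a\leq b \ \Rightarrow\ \vdash_{\mathrm{SOL}} a\leq b .$$
   Context: A bounded orthoposet $\langle P,\leq,{}^\bot\rangle$ is a partially ordered set with least element $0$ and greatest element $1$ and an orthocomplementation $a\mapsto a^\bot$, i.e. an order-reversing involution ($a\le b\Rightarrow b^\bot\le a^\bot$, $a^{\bot\bot}=a$) such that for every $a$ the meet of $a$ and $a^\bot$ exists and is $0$, and their join exists and is $1$. A Sasaki orthoposet is a tuple $\langle P,\leq,{}^\bot,\&\rangle$ where $\langle P,\leq,{}^\bot\rangle$ is a bounded orthoposet and $\&:P^2\to P$ is a total binary operation such that for all $a,b,c\in P$: (L-Monotony) $a\le b \Rightarrow a\,\&\,c\le b\,\&\,c$; (R-Reduction) $a\,\&\,b\le b$; (Orthomodularity) $a\le b\Rightarrow a=a\,\&\,b$; (Galois) $a\,\&\,b\le c\Rightarrow c^\bot\,\&\,b\le a^\bot$. Terms: $\mathcal L_\Psi$ is the set of terms generated by the grammar $t ::= p \mid t\,\&\,t \mid t^\bot$ with $p\in\Psi$ (purely syntactic; $t^{\bot\bot}$ is a different term from $t$). Semantics ($\mathrm{SOL}$): a $\Psi$-Sasaki model $\mathcal M$ is a Sasaki orthoposet $\langle P,\leq_P,{}^{\bot_P},\&_P\rangle$ together with a function $\nu:\Psi\to P$. The interpretation $[\![\cdot]\!]_{\mathcal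 M}:\mathcal L_\Psi\to P$ is defined inductively by $[\![p]\!]_{\mathcal M}=\nu(p)$ for $p\in\Psi$, $[\![t^\bot]\!]_{\mathcal M}=([\![t]\!]_{\mathcal M})^{\bot_P}$, $[\![t_1\,\&\,t_2]\!]_{\mathcal M}=[\![t_1]\!]_{\mathcal M}\,\&_P\,[\![t_2]\!]_{\mathcal M}$. One writes $\vdash_{\mathrm{SOL}} t_1\leq t_2$ iff $[\![t_1]\!]_{\mathcal M}\leq_P[\![t_2]\!]_{\mathcal M}$ for every $\Psi$-Sasaki model $\mathcal M$. Rules ($\mathrm{RSOL}$): $\vdash_{\mathrm{RSOL}} a\leq b$ means the formal inequality $a\le b$ is derivable by finite proof trees from the following rules, for arbitrary terms $a,b,c,d\in\mathcal L_\Psi$: ($A$) infer $a\leq a$ (no premise); ($S$) from $b^\bot\leq a^\bot$ infer $a\leq b$; ($G$) from $c^\bot\,\&\,b\leq a^\bot$ infer $a\,\&\,b\leq c$; ($N_L$) from $a\leq b$ infer $a^{\bot\bot}\leq b$; ($N_R$) from $a\leq b$ infer $a\leq b^{\bot\bot}$; ($T$) from $a\leq b$ and $b\leq c$ infer $a\leq c$; ($O_L$) from $a\leq b$ and $a\leq c$ infer $a\,\&\,b\leq c$; ($O_R$) from $a\leq b$ and $a\leq c$ infer $a\leq b\,\&\,c$; ($R$) from $b\leq c$ infer $a\,\&\,b\leq c$; ($M$) from $a\leq c$, $b\leq d$ and $d\leq b$ infer $a\,\&\,b\leq c\,\&\,d$. -}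

module Defs where

open import Algebra.Core using (Op₁; Op₂)
open import Algebra.Definitions using (Involutive; Congruent₂)
open import Data.Product.Base using (_×_)
open import Function.Base using (flip)
open import Level using (_⊔_; suc; Setω)
open import Relation.Binary.Bundles using (Poset)
open import Relation.Binary.Core using (Rel)
open import Relation.Binary.Definitions using (Minimum; Maximum)

IsMeet : ∀ {a ℓ} {A : Set a} → Rel A ℓ → A → A → A → Set (a ⊔ ℓ)
IsMeet _≤_ x y m = m ≤ x × m ≤ y × (∀ z → z ≤ x → z ≤ y → z ≤ m)

IsJoin : ∀ {a ℓ} {A : Set a} → Rel A ℓ → A → A → A → Set (a ⊔ ℓ)
IsJoin _≤_ = IsMeet (flip _≤_)

-- The underlying equality of a poset is a setoid equality _≈_.  No congruence
-- axiom is needed for _^⊥, since it follows from ^⊥-antitone and antisymmetry.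

record BoundedOrthoposet c ℓ₁ ℓ₂ : Set (suc (c ⊔ ℓ₁ ⊔ ℓ₂)) where
  infixl 9 _^⊥
  field
    poset : Poset c ℓ₁ ℓ₂

  open Poset poset public

  field
    0#            : Carrier
    1#            : Carrier
    _^⊥           : Op₁ Carrier
    minimum       : Minimum _≤_ 0#
    maximum       : Maximum _≤_ 1#
    ^⊥-antitone   : ∀ {a b} → a ≤ b → b ^⊥ ≤ a ^⊥
    ^⊥-involutive : Involutive _≈_ _^⊥
    ^⊥-meet       : ∀ a → IsMeet _≤_ a (a ^⊥) 0#
    ^⊥-join       : ∀ a → IsJoin _≤_ a (a ^⊥) 1#

-- &-cong says that _&_ is a well-defined operation on the setoid; it holds
-- automatically when _≈_ is propositional equality.

record SasakiOrthoposet c ℓ₁ ℓ₂ : Set (suc (c ⊔ ℓ₁ ⊔ ℓ₂)) where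
  infixl 7 _&_
  field
    boundedOrthoposet : BoundedOrthoposet c ℓ₁ ℓ₂

  open BoundedOrthoposet boundedOrthoposet public

  field
    _&_             : Op₂ Carrier
    &-cong          : Congruent₂ _≈_ _&_
    L-monotony      : ∀ {a b c} → a ≤ b → a & c ≤ b & c
    R-reduction     : ∀ a b → a & b ≤ b
    orthomodularity : ∀ {a b} → a ≤ b → a ≈ a & b
    galois          : ∀ {a b c} → a & b ≤ c → c ^⊥ & b ≤ a ^⊥

infixl 9 _^⊥
infixl 7 _&_

data Term {p} (Ψ : Set p) : Set p where
  atom : Ψ → Term Ψ
  _&_  : Term Ψ → Term Ψ → Term Ψ
  _^⊥  : Term Ψ → Term Ψ

record SasakiModel {p} (Ψ : Set p) c ℓ₁ ℓ₂ : Set (p ⊔ suc (c ⊔ ℓ₁ ⊔ ℓ₂)) where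
  field
    sasakiOrthoposet : SasakiOrthoposet c ℓ₁ ℓ₂

  module P = SasakiOrthoposet sasakiOrthoposet

  field
    ν : Ψ → P.Carrier

  ⟦_⟧ : Term Ψ → P.Carrier
  ⟦ atom q ⟧ = ν q
  ⟦ s & t ⟧  = ⟦ s ⟧ P.& ⟦ t ⟧
  ⟦ t ^⊥ ⟧   = ⟦ t ⟧ P.^⊥

infix 4 ⊢SOL_≤_ ⊢RSOL_≤_

-- Lives in Setω because models at all universe levels are considered.

⊢SOL_≤_ : ∀ {p} {Ψ : Set p} → Term Ψ → Term Ψ → Setω
⊢SOL_≤_ {Ψ = Ψ} s t =
  ∀ {c ℓ₁ ℓ₂} (M : SasakiModel Ψ c ℓ₁ ℓ₂) →
  let open SasakiModel M in ⟦ s ⟧ P.≤ ⟦ t ⟧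

data ⊢RSOL_≤_ {p} {Ψ : Set p} : Term Ψ → Term Ψ → Set p where
  A  : ∀ {a} → ⊢RSOL a ≤ a
  S  : ∀ {a b} → ⊢RSOL b ^⊥ ≤ a ^⊥ → ⊢RSOL a ≤ b
  G  : ∀ {a b c} → ⊢RSOL c ^⊥ & b ≤ a ^⊥ → ⊢RSOL a & b ≤ c
  Nₗ : ∀ {a b} → ⊢RSOL a ≤ b → ⊢RSOL a ^⊥ ^⊥ ≤ b
  Nᵣ : ∀ {a b} → ⊢RSOL a ≤ b → ⊢RSOL a ≤ b ^⊥ ^⊥
  T  : ∀ {a b c} → ⊢RSOL a ≤ b → ⊢RSOL b ≤ c → ⊢RSOL a ≤ c
  Oₗ : ∀ {a b c} → ⊢RSOL a ≤ b → ⊢RSOL a ≤ c → ⊢RSOL a & b ≤ c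
  Oᵣ : ∀ {a b c} → ⊢RSOL a ≤ b → ⊢RSOL a ≤ c → ⊢RSOL a ≤ b & c
  R  : ∀ {a b c} → ⊢RSOL b ≤ c → ⊢RSOL a & b ≤ c
  M  : ∀ {a b c d} → ⊢RSOL a ≤ c → ⊢RSOL b ≤ d → ⊢RSOL d ≤ b →
       ⊢RSOL a & b ≤ c & d

{-# OPTIONS --safe #-}
module Submission where

open import Defs hiding (_&_; _^⊥)

-- Induction on derivations: each rule holds in every Sasaki orthoposet. Involutivity settles `S`,
-- `Nₗ` and `Nᵣ`, and lets the Galois axiom be reversed for `G`; orthomodularity drives `Oₗ` and
-- `Oᵣ`.

module SasakiProperties {c ℓ₁ ℓ₂} (P : SasakiOrthoposet c ℓ₁ ℓ₂) where
  open SasakiOrthoposet P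

  x≤x⊥⊥ : ∀ x → x ≤ x ^⊥ ^⊥
  x≤x⊥⊥ x = reflexive (Eq.sym (^⊥-involutive x))

  x⊥⊥≤x : ∀ x → x ^⊥ ^⊥ ≤ x
  x⊥⊥≤x x = reflexive (^⊥-involutive x)

  ^⊥-cancel-≤ : ∀ {x y} → y ^⊥ ≤ x ^⊥ → x ≤ y
  ^⊥-cancel-≤ {x} {y} y⊥≤x⊥ = trans (x≤x⊥⊥ x) (trans (^⊥-antitone y⊥≤x⊥) (x⊥⊥≤x y))

  -- The Galois axiom yields `x ^⊥ ^⊥ & y ≤ z ^⊥ ^⊥`, whose double complements cancel.
  galois⁻¹ : ∀ {x y z} → z ^⊥ & y ≤ x ^⊥ → x & y ≤ z
  galois⁻¹ {x} {z = z} z⊥&y≤x⊥ =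
    trans (L-monotony (x≤x⊥⊥ x)) (trans (galois z⊥&y≤x⊥) (x⊥⊥≤x z))

  -- Orthomodularity rewrites `x` as `x & z`, so monotony on the left suffices.
  &-greatest : ∀ {x y z} → x ≤ y → x ≤ z → x ≤ y & z
  &-greatest x≤y x≤z = trans (reflexive (orthomodularity x≤z)) (L-monotony x≤y)

  -- In general `_&_` is not monotone on the right, hence an equality there.
  &-mono-≤-≈ : ∀ {x y z w} → x ≤ z → y ≈ w → x & y ≤ z & w
  &-mono-≤-≈ x≤z y≈w = trans (L-monotony x≤z) (reflexive (&-cong Eq.refl y≈w))

module Soundness {p c ℓ₁ ℓ₂} {Ψ : Set p} (𝓜 : SasakiModel Ψ c ℓ₁ ℓ₂) where
  open SasakiModel 𝓜
  open SasakiProperties sasakiOrthoposet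

  sound : ∀ {a b} → ⊢RSOL a ≤ b → ⟦ a ⟧ P.≤ ⟦ b ⟧
  sound A         = P.refl
  sound (S d)     = ^⊥-cancel-≤ (sound d)
  sound (G d)     = galois⁻¹ (sound d)
  sound (Nₗ d)    = P.trans (x⊥⊥≤x _) (sound d)
  sound (Nᵣ d)    = P.trans (sound d) (x≤x⊥⊥ _)
  sound (T d e)   = P.trans (sound d) (sound e)
  sound (Oₗ d e)  = P.trans (P.reflexive (P.Eq.sym (P.orthomodularity (sound d)))) (sound e)
  sound (Oᵣ d e)  = &-greatest (sound d) (sound e)
  sound (R d)     = P.trans (P.R-reduction _ _) (sound d)
  -- Possibly distinct right-hand terms become equal in the model by antisymmetry.
  sound (M d e f) = &-mono-≤-≈ (sound d) (P.antisym (sound e) (sound f))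

proposition7 : ∀ {p} (Ψ : Set p) (a b : Term Ψ) → ⊢RSOL a ≤ b → ⊢SOL a ≤ b
proposition7 Ψ a b d 𝓜 = Soundness.sound 𝓜 d
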